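{- There are closed terms $s$ and $t$ (of Gödel's $T$) such that $\textsf{E-PA}^{\omega*}$ proves \[ (\forall \Omega)\big(\textsf{MUC}(\Omega)\rightarrow \textsf{SFF}(t(\Omega))\big)\ \wedge\ (\forall \Theta)\big(\textsf{SFF}(\Theta)\rightarrow \textsf{FAN}_{\textsf{ef}}(s(\Theta))\big). \]
   Context: Types: $0$ is the type of natural numbers, $1=0\to0$, $2=1\to 0$, and $\tau^*$ is the type of finite sequences of objects of type $\tau$. $\textsf{E-PA}^{\omega}$ is (classical) Peano arithmetic in all finite types with the axiom of extensionality; $\textsf{E-PA}^{\omega*}$ is its definitional extension with types $\tau^*$ for finite sequences. Its closed terms are those of Gödel's $T$ (with finite sequence types). For $w$ of type $\tau^*$, $g\in w$ means that $g$ equals one of the entries of $w$. $f\leq_1 1$ means $f(n)\le 1$ for all $n$. For $f^1$ and $N^0$, $\overline{f}N=\langle f(0),\dots,f(N-1)\rangle$ is the initial segment of $f$ of length $N$; for a finite sequence $\sigma$ of numbers, $f\in[\sigma]$ means that $f$ extends $\sigma$. A variable $T\leq_1 1$ followed by membership "$\sigma\in T$" ranges over binary trees (downward closed sets of finite binary sequences, given by their characteristic functions). $\textsf{MUC}(\Omega)$, for $\Omega$ of type $2\to 0$ (the intuitionistic fan functional): $(\forall Y^{2})(\forall f^1,g^1\leq_1 1)\big(\overline{f}\Omega(Y)=\overline{g}\Omega(Y)\rightarrow Y(f)=Y(g)\big)$. $\textsf{SFF}(\Theta)$, for $\Theta$ of type $2\to1^*$ (special fan functional): $(\forall G^2)(\forall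 f^1\leq_1 1)(\exists g\in\Theta(G))\big(f\in[\overline{g}G(g)]\big)$. $\textsf{FAN}_{\textsf{ef}}(h)$, for $h$ of type $(2\times 1)\to 0$: $(\forall T\leq_1 1)(\forall g^2)\big[(\forall\alpha\leq_1 1)(\overline{\alpha}g(\alpha)\notin T)\rightarrow(\forall\beta\leq_1 1)(\overline{\beta}h(g,T)\notin T)\big]$. -}

module Defs where

open import Data.List using (List; []; _∷_; map)
open import Data.List.Membership.Propositional using (_∈_)

infixr 7 _⇒_
infix  9 _*
infixl 8 _·_
infix  4 _∋_
infix  2 _⊢_
infix  6 _≐_ _≤′_ _<′_ _∈′_ _∈[_] _∈ᵀ_ _∉ᵀ_ _≤₁1 _⊑_
infix  9 ↑_
infix  7 ¬′_
infixr 5 _∧′_ _∨′_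
infixr 4 _⊃_
infix  3 ∀[_]_ ∃[_]_

data Ty : Set where
  𝟘   : Ty
  _⇒_ : Ty → Ty → Ty
  _*  : Ty → Ty

𝟙 𝟚 : Ty
𝟙 = 𝟘 ⇒ 𝟘
𝟚 = 𝟙 ⇒ 𝟘

Ctx : Set
Ctx = List Ty

variable
  Δ Δ′ : Ctx
  ρ σ τ : Ty

data _∋_ : Ctx → Ty → Set where
  Z : τ ∷ Δ ∋ τ
  S : Δ ∋ τ → σ ∷ Δ ∋ τ

data Tm (Δ : Ctx) : Ty → Set where
  var     : Δ ∋ τ → Tm Δ τ
  lam     : Tm (σ ∷ Δ) τ → Tm Δ (σ ⇒ τ)
  _·_     : Tm Δ (σ ⇒ τ) → Tm Δ σ → Tm Δ τ
  zero    : Tm Δ 𝟘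
  suc     : Tm Δ (𝟘 ⇒ 𝟘)
  rec     : Tm Δ (ρ ⇒ (𝟘 ⇒ ρ ⇒ ρ) ⇒ 𝟘 ⇒ ρ)
  nil     : Tm Δ (σ *)
  cons    : Tm Δ (σ ⇒ σ * ⇒ σ *)
  listrec : Tm Δ (ρ ⇒ (σ ⇒ σ * ⇒ ρ ⇒ ρ) ⇒ σ * ⇒ ρ)

ClosedTm : Ty → Set
ClosedTm = Tm []

-- Equality is primitive at every type; together with the Leibniz rule `≐-subst`
-- and `ext` below it is provably pointwise equality at function types.
data Fm (Δ : Ctx) : Set where
  _≐_            : Tm Δ τ → Tm Δ τ → Fm Δ
  ⊥′             : Fm Δ
  _⊃_ _∧′_ _∨′_ : Fm Δ → Fm Δ → Fm Δ
  ∀[_]_ ∃[_]_    : ∀ τ → Fm (τ ∷ Δ) → Fm Δ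

¬′_ : Fm Δ → Fm Δ
¬′ A = A ⊃ ⊥′

Ren Sub : Ctx → Ctx → Set
Ren Δ Δ′ = ∀ {τ} → Δ ∋ τ → Δ′ ∋ τ
Sub Δ Δ′ = ∀ {τ} → Δ ∋ τ → Tm Δ′ τ

extR : Ren Δ Δ′ → Ren (σ ∷ Δ) (σ ∷ Δ′)
extR r Z     = Z
extR r (S x) = S (r x)

ren : Ren Δ Δ′ → Tm Δ τ → Tm Δ′ τ
ren r (var x) = var (r x)
ren r (lam t) = lam (ren (extR r) t)
ren r (t · u) = ren r t · ren r u
ren r zero    = zero
ren r suc     = suc
ren r rec     = rec
ren r nil     = nil
ren r cons    = cons
ren r listrec = listrec

↑_ : Tm Δ τ → Tm (σ ∷ Δ) τ
↑_ = ren S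

⌜_⌝ : ClosedTm τ → Tm Δ τ
⌜_⌝ = ren (λ ())

extS : Sub Δ Δ′ → Sub (σ ∷ Δ) (σ ∷ Δ′)
extS s Z     = var Z
extS s (S x) = ↑ s x

sub : Sub Δ Δ′ → Tm Δ τ → Tm Δ′ τ
sub s (var x) = s x
sub s (lam t) = lam (sub (extS s) t)
sub s (t · u) = sub s t · sub s u
sub s zero    = zero
sub s suc     = suc
sub s rec     = rec
sub s nil     = nil
sub s cons    = cons
sub s listrec = listrec

renF : Ren Δ Δ′ → Fm Δ → Fm Δ′
renF r (t ≐ u)    = ren r t ≐ ren r u
renF r ⊥′         = ⊥′
renF r (A ⊃ B)    = renF r A ⊃ renF r B
renF r (A ∧′ B)   = renF r A ∧′ renF r B
renF r (A ∨′ B)   = renF r A ∨′ renF r B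
renF r (∀[ τ ] A) = ∀[ τ ] renF (extR r) A
renF r (∃[ τ ] A) = ∃[ τ ] renF (extR r) A

subF : Sub Δ Δ′ → Fm Δ → Fm Δ′
subF s (t ≐ u)    = sub s t ≐ sub s u
subF s ⊥′         = ⊥′
subF s (A ⊃ B)    = subF s A ⊃ subF s B
subF s (A ∧′ B)   = subF s A ∧′ subF s B
subF s (A ∨′ B)   = subF s A ∨′ subF s B
subF s (∀[ τ ] A) = ∀[ τ ] subF (extS s) A
subF s (∃[ τ ] A) = ∃[ τ ] subF (extS s) A

inst : Tm Δ σ → Sub (σ ∷ Δ) Δ
inst u Z     = u
inst u (S x) = var x

_[_] : Tm (σ ∷ Δ) τ → Tm Δ σ → Tm Δ τ
t [ u ] = sub (inst u) t

_[_]F : Fm (σ ∷ Δ) → Tm Δ σ → Fm Δ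
A [ u ]F = subF (inst u) A

-- A(x) ↦ A(x + 1), for x the most recently bound variable.
succSub : Sub (𝟘 ∷ Δ) (𝟘 ∷ Δ)
succSub Z     = suc · var Z
succSub (S x) = var (S x)

-- E-PA^ω*: classical many-sorted natural deduction with equality, where Δ
-- declares the free variables and Γ lists the hypotheses. The ξ and η rules for
-- `lam` follow from `β` and `ext`.
data _⊢_ {Δ : Ctx} (Γ : List (Fm Δ)) : Fm Δ → Set where
  hyp     : ∀ {A} → A ∈ Γ → Γ ⊢ A
  ⊥-elim  : ∀ {A} → Γ ⊢ ⊥′ → Γ ⊢ A
  ⊃-intro : ∀ {A B} → A ∷ Γ ⊢ B → Γ ⊢ A ⊃ B
  ⊃-elim  : ∀ {A B} → Γ ⊢ A ⊃ B → Γ ⊢ A → Γ ⊢ B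
  ∧-intro : ∀ {A B} → Γ ⊢ A → Γ ⊢ B → Γ ⊢ A ∧′ B
  ∧-elim₁ : ∀ {A B} → Γ ⊢ A ∧′ B → Γ ⊢ A
  ∧-elim₂ : ∀ {A B} → Γ ⊢ A ∧′ B → Γ ⊢ B
  ∨-intro₁ : ∀ {A B} → Γ ⊢ A → Γ ⊢ A ∨′ B
  ∨-intro₂ : ∀ {A B} → Γ ⊢ B → Γ ⊢ A ∨′ B
  ∨-elim  : ∀ {A B C} → Γ ⊢ A ∨′ B → A ∷ Γ ⊢ C → B ∷ Γ ⊢ C → Γ ⊢ C
  ∀-intro : ∀ {A : Fm (τ ∷ Δ)} → map (renF S) Γ ⊢ A → Γ ⊢ ∀[ τ ] A
  ∀-elim  : ∀ {A : Fm (τ ∷ Δ)} → Γ ⊢ ∀[ τ ] A → (t : Tm Δ τ) → Γ ⊢ A [ t ]F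
  ∃-intro : ∀ {A : Fm (τ ∷ Δ)} (t : Tm Δ τ) → Γ ⊢ A [ t ]F → Γ ⊢ ∃[ τ ] A
  ∃-elim  : ∀ {A : Fm (τ ∷ Δ)} {B} →
            Γ ⊢ ∃[ τ ] A → A ∷ map (renF S) Γ ⊢ renF S B → Γ ⊢ B
  lem     : ∀ {A} → Γ ⊢ A ∨′ (¬′ A)

  ≐-refl  : {t : Tm Δ τ} → Γ ⊢ t ≐ t
  ≐-subst : (A : Fm (τ ∷ Δ)) {t u : Tm Δ τ} →
            Γ ⊢ t ≐ u → Γ ⊢ A [ t ]F → Γ ⊢ A [ u ]F
  ext     : {f g : Tm Δ (σ ⇒ τ)} →
            Γ ⊢ ∀[ σ ] (↑ f · var Z ≐ ↑ g · var Z) → Γ ⊢ f ≐ g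
  β       : {t : Tm (σ ∷ Δ) τ} {u : Tm Δ σ} → Γ ⊢ lam t · u ≐ t [ u ]

  suc≢0   : {t : Tm Δ 𝟘} → Γ ⊢ ¬′ (suc · t ≐ zero)
  suc-inj : {t u : Tm Δ 𝟘} → Γ ⊢ suc · t ≐ suc · u → Γ ⊢ t ≐ u
  ind     : (A : Fm (𝟘 ∷ Δ)) →
            Γ ⊢ A [ zero ]F → Γ ⊢ ∀[ 𝟘 ] (A ⊃ subF succSub A) → Γ ⊢ ∀[ 𝟘 ] A
  rec-zero : {y : Tm Δ ρ} {z : Tm Δ (𝟘 ⇒ ρ ⇒ ρ)} → Γ ⊢ rec · y · z · zero ≐ y
  rec-suc  : {y : Tm Δ ρ} {z : Tm Δ (𝟘 ⇒ ρ ⇒ ρ)} {n : Tm Δ 𝟘} →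
             Γ ⊢ rec · y · z · (suc · n) ≐ z · n · (rec · y · z · n)

  -- Induction along sequences follows from `seq-cases` by induction on length.
  seq-cases : {w : Tm Δ (σ *)} →
              Γ ⊢ (w ≐ nil)
                  ∨′ (∃[ σ ] ∃[ σ * ] (↑ ↑ w ≐ cons · var (S Z) · var Z))
  listrec-nil  : {y : Tm Δ ρ} {z : Tm Δ (σ ⇒ σ * ⇒ ρ ⇒ ρ)} →
                 Γ ⊢ listrec · y · z · nil ≐ y
  listrec-cons : {y : Tm Δ ρ} {z : Tm Δ (σ ⇒ σ * ⇒ ρ ⇒ ρ)}
                 {a : Tm Δ σ} {w : Tm Δ (σ *)} →
                 Γ ⊢ listrec · y · z · (cons · a · w)
                     ≐ z · a · w · (listrec · y · z · w)

E-PAω*⊢_ : Fm [] → Set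
E-PAω*⊢ A = [] ⊢ A

infix 2 E-PAω*⊢_

v0 : Tm (τ ∷ Δ) τ
v0 = var Z

v1 : Tm (σ ∷ τ ∷ Δ) τ
v1 = var (S Z)

v2 : Tm (ρ ∷ σ ∷ τ ∷ Δ) τ
v2 = var (S (S Z))

v3 : ∀ {υ} → Tm (υ ∷ ρ ∷ σ ∷ τ ∷ Δ) τ
v3 = var (S (S (S Z)))

one : Tm Δ 𝟘
one = suc · zero

-- x + 0 = x,  x + (y + 1) = (x + y) + 1
plus : Tm Δ (𝟘 ⇒ 𝟘 ⇒ 𝟘)
plus = lam (lam (rec · v1 · lam suc · v0))

_≤′_ _<′_ : Tm Δ 𝟘 → Tm Δ 𝟘 → Fm Δ
m ≤′ n = ∃[ 𝟘 ] (plus · ↑ m · v0 ≐ ↑ n)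
m <′ n = suc · m ≤′ n

_≤₁1 : Tm Δ 𝟙 → Fm Δ
f ≤₁1 = ∀[ 𝟘 ] (↑ f · v0 ≤′ one)

len : Tm Δ (τ * ⇒ 𝟘)
len = listrec · zero · lam (lam suc)

append : Tm Δ (τ * ⇒ τ * ⇒ τ *)
append = lam (lam (listrec · v0 · lam (lam (cons · v1)) · v1))

default : (τ : Ty) → Tm Δ τ
default 𝟘       = zero
default (σ ⇒ τ) = lam (default τ)
default (τ *)   = nil

-- nth · w · i is the entry (w)ᵢ when i < |w|, and a default object otherwise.
nth : Tm Δ (τ * ⇒ 𝟘 ⇒ τ)
nth {τ = τ} =
  listrec · lam (default τ)
          · lam (lam (lam (lam (rec · v3 · lam (lam (v3 · v1)) · v0))))

-- bar · f · N = ⟨ f(0), …, f(N-1) ⟩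
bar : Tm Δ (𝟙 ⇒ 𝟘 ⇒ 𝟘 *)
bar = lam (lam (rec · nil · lam (lam (append · v0 · (cons · (v3 · v1) · nil))) · v0))

_∈′_ : Tm Δ τ → Tm Δ (τ *) → Fm Δ
g ∈′ w = ∃[ 𝟘 ] ((v0 <′ len · ↑ w) ∧′ (↑ g ≐ nth · ↑ w · v0))

_∈[_] : Tm Δ 𝟙 → Tm Δ (𝟘 *) → Fm Δ
f ∈[ w ] = ∀[ 𝟘 ] (v0 <′ len · ↑ w ⊃ ↑ f · v0 ≐ nth · ↑ w · v0)

-- Cantor pairing: pair x y = (0 + 1 + … + (x + y)) + y.
pair : Tm Δ (𝟘 ⇒ 𝟘 ⇒ 𝟘)
pair = lam (lam (plus · (triangle · (plus · v1 · v0)) · v0))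
  where
  triangle : Tm Δ′ (𝟘 ⇒ 𝟘)
  triangle = rec · zero · lam (lam (plus · v0 · (suc · v1)))

-- A tree is an object of type 1, so its elements are numbers; sequences are
-- coded by the bijection code ⟨⟩ = 0, code (a ∷ w) = 1 + pair a (code w).
code : Tm Δ (𝟘 * ⇒ 𝟘)
code = listrec · zero · lam (lam (lam (suc · (pair · v2 · v0))))

_∈ᵀ_ _∉ᵀ_ : Tm Δ (𝟘 *) → Tm Δ 𝟙 → Fm Δ
w ∈ᵀ T = T · (code · w) ≐ one
w ∉ᵀ T = ¬′ (w ∈ᵀ T)


IsBinarySeq : Tm Δ (𝟘 *) → Fm Δ
IsBinarySeq w = ∀[ 𝟘 ] (v0 <′ len · ↑ w ⊃ nth · ↑ w · v0 ≤′ one)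

_⊑_ : Tm Δ (𝟘 *) → Tm Δ (𝟘 *) → Fm Δ
u ⊑ w = ∃[ 𝟘 * ] (append · ↑ u · v0 ≐ ↑ w)

IsBinaryTree : Tm Δ 𝟙 → Fm Δ
IsBinaryTree T =
  T ≤₁1
  ∧′ (∀[ 𝟘 * ] (v0 ∈ᵀ ↑ T ⊃ IsBinarySeq v0))
  ∧′ (∀[ 𝟘 * ] ∀[ 𝟘 * ]
       let T = ↑ ↑ T; w = v1; u = v0 in
       w ∈ᵀ T ⊃ u ⊑ w ⊃ u ∈ᵀ T)

MUC : Tm Δ (𝟚 ⇒ 𝟘) → Fm Δ
MUC Ω =
  ∀[ 𝟚 ] ∀[ 𝟙 ] ∀[ 𝟙 ]
  let Ω = ↑ ↑ ↑ Ω; Y = v2; f = v1; g = v0 in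
  f ≤₁1 ⊃ g ≤₁1 ⊃
  bar · f · (Ω · Y) ≐ bar · g · (Ω · Y) ⊃ Y · f ≐ Y · g

SFF : Tm Δ (𝟚 ⇒ 𝟙 *) → Fm Δ
SFF Θ =
  ∀[ 𝟚 ] ∀[ 𝟙 ]
  (v0 ≤₁1 ⊃
   (∃[ 𝟙 ]
     let Θ = ↑ ↑ ↑ Θ; G = v2; f = v1; g = v0 in
     (g ∈′ Θ · G) ∧′ (f ∈[ bar · g · (G · g) ])))

-- h takes its two arguments in curried form.
FANef : Tm Δ (𝟚 ⇒ 𝟙 ⇒ 𝟘) → Fm Δ
FANef h =
  ∀[ 𝟙 ]
  (IsBinaryTree v0 ⊃
   (∀[ 𝟚 ]
     ((∀[ 𝟙 ]
        let T = v2; g = v1; α = v0 in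
        α ≤₁1 ⊃ bar · α · (g · α) ∉ᵀ T)
      ⊃
      (∀[ 𝟙 ]
        let h = ↑ ↑ ↑ h; T = v2; g = v1; β = v0 in
        β ≤₁1 ⊃ bar · β · (h · g · T) ∉ᵀ T))))

{-# OPTIONS --safe #-}
module Submission where

-- For the first half, let M be the modulus Ω(G) plus the modulus of
-- f ↦ f(G(f)), and let t(Ω)(G) list the σ * 000… for σ binary of length M. The
-- entry g agreeing with f below M satisfies G(g) ≤ M: otherwise G takes the same
-- value ≥ M at f̄M * 000… and f̄M * 111…, where these sequences differ, although
-- f ↦ f(G(f)) cannot separate them. Hence g agrees with f below G(g).
--
-- For the second half, entries of Θ need not be binary, so Θ is applied to
-- G(γ) = g(min(γ, 1)). A binary f agrees below G(γ) with min(γ, 1) for some entry γ,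
-- so f has left T by length G(γ), hence by the sum of G over all entries.

open import Data.List using (List; []; _∷_; map)
open import Data.List.Relation.Unary.Any using (here; there)
open import Data.Maybe using (Maybe; just; nothing)
open import Data.Nat using (ℕ; zero; suc)
open import Data.Product using (Σ-syntax; _,_; proj₁; proj₂)
open import Relation.Binary.PropositionalEquality
  using (_≡_; refl; sym; cong; cong₂; subst; subst₂)
open import Defs

variable
  Γ : List (Fm Δ)
  A B C : Fm Δ

-- Renaming followed by substitution.

sub-ren-id : {r : Ren Δ Δ′} {s : Sub Δ′ Δ} →
             (∀ {τ} (x : Δ ∋ τ) → s (r x) ≡ var x) →
             (t : Tm Δ τ) → sub s (ren r t) ≡ t

extS-extR-id : {r : Ren Δ Δ′} {s : Sub Δ′ Δ} →
               (∀ {τ} (x : Δ ∋ τ) → s (r x) ≡ var x) →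
               (x : σ ∷ Δ ∋ τ) → extS s (extR r x) ≡ var x
extS-extR-id e Z     = refl
extS-extR-id e (S x) = cong ↑_ (e x)

sub-ren-id e (var x) = e x
sub-ren-id e (lam t) = cong lam (sub-ren-id (extS-extR-id e) t)
sub-ren-id e (t · u) = cong₂ _·_ (sub-ren-id e t) (sub-ren-id e u)
sub-ren-id e zero    = refl
sub-ren-id e suc     = refl
sub-ren-id e rec     = refl
sub-ren-id e nil     = refl
sub-ren-id e cons    = refl
sub-ren-id e listrec = refl

subF-renF-id : {r : Ren Δ Δ′} {s : Sub Δ′ Δ} →
               (∀ {τ} (x : Δ ∋ τ) → s (r x) ≡ var x) →
               (A : Fm Δ) → subF s (renF r A) ≡ A
subF-renF-id e (t ≐ u)    = cong₂ _≐_ (sub-ren-id e t) (sub-ren-id e u)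
subF-renF-id e ⊥′         = refl
subF-renF-id e (A ⊃ B)    = cong₂ _⊃_ (subF-renF-id e A) (subF-renF-id e B)
subF-renF-id e (A ∧′ B)   = cong₂ _∧′_ (subF-renF-id e A) (subF-renF-id e B)
subF-renF-id e (A ∨′ B)   = cong₂ _∨′_ (subF-renF-id e A) (subF-renF-id e B)
subF-renF-id e (∀[ τ ] A) = cong (∀[ τ ]_) (subF-renF-id (extS-extR-id e) A)
subF-renF-id e (∃[ τ ] A) = cong (∃[ τ ]_) (subF-renF-id (extS-extR-id e) A)

↑-[] : (t : Tm Δ τ) {u : Tm Δ σ} → (↑ t) [ u ] ≡ t
↑-[] t {u} = sub-ren-id {s = inst u} (λ _ → refl) t

inst-v0-extR : (x : σ ∷ Δ ∋ τ) → inst v0 (extR S x) ≡ var x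
inst-v0-extR Z     = refl
inst-v0-extR (S x) = refl

ren-[v0] : (t : Tm (σ ∷ Δ) τ) → ren (extR S) t [ v0 ] ≡ t
ren-[v0] = sub-ren-id {r = extR S} {s = inst v0} inst-v0-extR

-- Weakening a quantified formula renames beneath its binder; instantiating the outcome at the fresh
-- `v0` then returns the original body.
renF-[v0] : (A : Fm (σ ∷ Δ)) → renF (extR S) A [ v0 ]F ≡ A
renF-[v0] = subF-renF-id {r = extR S} {s = inst v0} inst-v0-extR

-- Equality reasoning inside the theory.

≐-sym : {t u : Tm Δ τ} → Γ ⊢ t ≐ u → Γ ⊢ u ≐ t
≐-sym {Γ = Γ} {t} {u} e =
  subst (λ z → Γ ⊢ u ≐ z) (↑-[] t)
    (≐-subst (v0 ≐ ↑ t) e (subst (λ z → Γ ⊢ t ≐ z) (sym (↑-[] t)) ≐-refl))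

≐-trans : {t u v : Tm Δ τ} → Γ ⊢ t ≐ u → Γ ⊢ u ≐ v → Γ ⊢ t ≐ v
≐-trans {Γ = Γ} {t} {u} {v} d e =
  subst (λ z → Γ ⊢ z ≐ v) (↑-[] t)
    (≐-subst (↑ t ≐ v0) e (subst (λ z → Γ ⊢ z ≐ u) (sym (↑-[] t)) d))

cong-[] : (C : Tm (σ ∷ Δ) τ) {t u : Tm Δ σ} → Γ ⊢ t ≐ u → Γ ⊢ C [ t ] ≐ C [ u ]
cong-[] {Γ = Γ} C {t} {u} e =
  subst (λ z → Γ ⊢ z ≐ C [ u ]) (↑-[] (C [ t ]))
    (≐-subst (↑ (C [ t ]) ≐ C) e
      (subst (λ z → Γ ⊢ z ≐ C [ t ]) (sym (↑-[] (C [ t ]))) ≐-refl))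

congʳ : (f : Tm Δ (σ ⇒ τ)) {t u : Tm Δ σ} → Γ ⊢ t ≐ u → Γ ⊢ f · t ≐ f · u
congʳ {Γ = Γ} f {t} {u} e =
  subst₂ (λ x y → Γ ⊢ x · t ≐ y · u) (↑-[] f) (↑-[] f) (cong-[] (↑ f · v0) e)

congˡ : {f g : Tm Δ (σ ⇒ τ)} → Γ ⊢ f ≐ g → (t : Tm Δ σ) → Γ ⊢ f · t ≐ g · t
congˡ {Γ = Γ} {f = f} {g} e t =
  subst₂ (λ x y → Γ ⊢ f · x ≐ g · y) (↑-[] t) (↑-[] t) (cong-[] (v0 · ↑ t) e)

cong· : {f g : Tm Δ (σ ⇒ τ)} {t u : Tm Δ σ} →
        Γ ⊢ f ≐ g → Γ ⊢ t ≐ u → Γ ⊢ f · t ≐ g · u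
cong· {g = g} {t = t} d e = ≐-trans (congˡ d t) (congʳ g e)

-- The premise is demanded under every list of hypotheses because `∀-intro` weakens the list before
-- the equation is used.
ξ : {t u : Tm (σ ∷ Δ) τ} → (∀ {Γ} → Γ ⊢ t ≐ u) → Γ ⊢ lam t ≐ lam u
ξ {t = t} {u} e = ext (∀-intro (≐-trans (β-v0 t) (≐-trans e (≐-sym (β-v0 u)))))
  where
  β-v0 : ∀ {Γ} t → Γ ⊢ ↑ lam t · v0 ≐ t
  β-v0 {Γ} t = subst (λ z → Γ ⊢ ↑ lam t · v0 ≐ z) (ren-[v0] t) β

-- Provably correct normalisation of terms and formulas.

Reduct : Tm Δ τ → Set
Reduct {Δ} {τ} t = Σ[ u ∈ Tm Δ τ ] (∀ {Γ} → Γ ⊢ t ≐ u)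

contract : (t : Tm Δ (σ ⇒ τ)) (u : Tm Δ σ) → Maybe (Reduct (t · u))
contract (lam t)           u              = just (_ , β)
contract (rec · y · z)     zero           = just (_ , rec-zero)
contract (rec · y · z)     (suc · n)      = just (_ , rec-suc)
contract (listrec · y · z) nil            = just (_ , listrec-nil)
contract (listrec · y · z) (cons · a · w) = just (_ , listrec-cons)
contract _                 _              = nothing

-- Fuel is not spent on descent into subterms, only on passing to the outcome of a contraction.
-- Running out leaves a less reduced term that is still provably equal.
reduce : ℕ → (t : Tm Δ τ) → Reduct t
reduce-· : ℕ → (t : Tm Δ (σ ⇒ τ)) (u : Tm Δ σ) → Reduct (t · u)

reduce zero    t       = t , ≐-refl
reduce (suc n) (lam t) with reduce (suc n) t
... | t′ , e = lam t′ , ξ e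
reduce (suc n) (t · u) with reduce (suc n) t | reduce (suc n) u
... | t′ , d | u′ , e with reduce-· n t′ u′
... | v , h = v , ≐-trans (cong· d e) h
reduce (suc n) t       = t , ≐-refl

reduce-· n t u with contract t u
... | nothing      = t · u , ≐-refl
... | just (v , d) with reduce n v
... | v′ , e = v′ , ≐-trans d e

Equivalent : Fm Δ → Set
Equivalent {Δ} A = Σ[ B ∈ Fm Δ ] (∀ {Γ} → Γ ⊢ (A ⊃ B) ∧′ (B ⊃ A))

h0 : A ∷ Γ ⊢ A
h0 = hyp (here refl)

h1 : A ∷ B ∷ Γ ⊢ B
h1 = hyp (there (here refl))

h2 : ∀ {A₀ A₁} → A₀ ∷ A₁ ∷ A ∷ Γ ⊢ A
h2 = hyp (there (there (here refl)))

h3 : ∀ {A₀ A₁ A₂} → A₀ ∷ A₁ ∷ A₂ ∷ A ∷ Γ ⊢ A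
h3 = hyp (there (there (there (here refl))))

h4 : ∀ {A₀ A₁ A₂ A₃} → A₀ ∷ A₁ ∷ A₂ ∷ A₃ ∷ A ∷ Γ ⊢ A
h4 = hyp (there (there (there (there (here refl)))))

h5 : ∀ {A₀ A₁ A₂ A₃ A₄} → A₀ ∷ A₁ ∷ A₂ ∷ A₃ ∷ A₄ ∷ A ∷ Γ ⊢ A
h5 = hyp (there (there (there (there (there (here refl))))))

h6 : ∀ {A₀ A₁ A₂ A₃ A₄ A₅} → A₀ ∷ A₁ ∷ A₂ ∷ A₃ ∷ A₄ ∷ A₅ ∷ A ∷ Γ ⊢ A
h6 = hyp (there (there (there (there (there (there (here refl)))))))

∀-mono : {A B : Fm (τ ∷ Δ)} → (∀ {Γ} → Γ ⊢ A ⊃ B) → Γ ⊢ (∀[ τ ] A) ⊃ (∀[ τ ] B)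
∀-mono {A = A} d =
  ⊃-intro (∀-intro (⊃-elim d (subst (_⊢_ _) (renF-[v0] A) (∀-elim h0 v0))))

∃-mono : {A B : Fm (τ ∷ Δ)} → (∀ {Γ} → Γ ⊢ A ⊃ B) → Γ ⊢ (∃[ τ ] A) ⊃ (∃[ τ ] B)
∃-mono {B = B} d =
  ⊃-intro (∃-elim h0 (∃-intro v0 (subst (_⊢_ _) (sym (renF-[v0] B)) (⊃-elim d h0))))

≐-resp : {t t′ u u′ : Tm Δ τ} → (∀ {Γ} → Γ ⊢ t ≐ t′) → (∀ {Γ} → Γ ⊢ u ≐ u′) →
         Γ ⊢ (t ≐ u) ⊃ (t′ ≐ u′)
≐-resp d e = ⊃-intro (≐-trans (≐-sym d) (≐-trans h0 e))

normalise : (A : Fm Δ) → Equivalent A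
-- Fuel 40 suffices for the conversions below; the equivalence is provable for any amount.
normalise (t ≐ u) with reduce 40 t | reduce 40 u
... | t′ , d | u′ , e =
  (t′ ≐ u′) , ∧-intro (≐-resp d e) (≐-resp (≐-sym d) (≐-sym e))
normalise ⊥′ = ⊥′ , ∧-intro (⊃-intro h0) (⊃-intro h0)
normalise (A ⊃ B) with normalise A | normalise B
... | A′ , d | B′ , e =
  (A′ ⊃ B′) ,
  ∧-intro (⊃-intro (⊃-intro (⊃-elim (∧-elim₁ e) (⊃-elim h1 (⊃-elim (∧-elim₂ d) h0)))))
          (⊃-intro (⊃-intro (⊃-elim (∧-elim₂ e) (⊃-elim h1 (⊃-elim (∧-elim₁ d) h0)))))
normalise (A ∧′ B) with normalise A | normalise B
... | A′ , d | B′ , e =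
  (A′ ∧′ B′) ,
  ∧-intro (⊃-intro (∧-intro (⊃-elim (∧-elim₁ d) (∧-elim₁ h0))
                            (⊃-elim (∧-elim₁ e) (∧-elim₂ h0))))
          (⊃-intro (∧-intro (⊃-elim (∧-elim₂ d) (∧-elim₁ h0))
                            (⊃-elim (∧-elim₂ e) (∧-elim₂ h0))))
normalise (A ∨′ B) with normalise A | normalise B
... | A′ , d | B′ , e =
  (A′ ∨′ B′) ,
  ∧-intro (⊃-intro (∨-elim h0 (∨-intro₁ (⊃-elim (∧-elim₁ d) h0))
                              (∨-intro₂ (⊃-elim (∧-elim₁ e) h0))))
          (⊃-intro (∨-elim h0 (∨-intro₁ (⊃-elim (∧-elim₂ d) h0))
                              (∨-intro₂ (⊃-elim (∧-elim₂ e) h0))))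
normalise (∀[ τ ] A) with normalise A
... | A′ , d = (∀[ τ ] A′) , ∧-intro (∀-mono (∧-elim₁ d)) (∀-mono (∧-elim₂ d))
normalise (∃[ τ ] A) with normalise A
... | A′ , d = (∃[ τ ] A′) , ∧-intro (∃-mono (∧-elim₁ d)) (∃-mono (∧-elim₂ d))

infix 4 _≃_

_≃_ : Fm Δ → Fm Δ → Set
A ≃ B = proj₁ (normalise A) ≡ proj₁ (normalise B)

-- Lets instance search discharge A ≃ B by evaluating both normal forms.
instance
  ≡-refl : {X : Set} {x : X} → x ≡ x
  ≡-refl = refl

conv : ⦃ A ≃ B ⦄ → Γ ⊢ A → Γ ⊢ B
conv {A = A} {B = B} ⦃ e ⦄ d =
  ⊃-elim (∧-elim₂ (proj₂ (normalise B)))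
    (subst (_⊢_ _) e (⊃-elim (∧-elim₁ (proj₂ (normalise A))) d))

-- Derivation steps up to normalisation.

infixl 5 _at_ _by_

_at_ : {A : Fm (τ ∷ Δ)} → Γ ⊢ ∀[ τ ] A → (t : Tm Δ τ) → Γ ⊢ A [ t ]F
_at_ = ∀-elim

_by_ : Γ ⊢ A ⊃ B → Γ ⊢ A → Γ ⊢ B
_by_ = ⊃-elim

have : Γ ⊢ A → A ∷ Γ ⊢ B → Γ ⊢ B
have d e = ⊃-elim (⊃-intro e) d

compute : {t u : Tm Δ τ} → ⦃ (t ≐ t) ≃ (t ≐ u) ⦄ → Γ ⊢ t ≐ u
compute {t = t} = conv {A = t ≐ t} ≐-refl

-- In `A` the variable `v0` marks the occurrences to be replaced; both end formulas are matched only
-- up to normalisation.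
rewriting : (A : Fm (τ ∷ Δ)) {t u : Tm Δ τ} → Γ ⊢ t ≐ u →
            Γ ⊢ B → ⦃ B ≃ A [ t ]F ⦄ → ⦃ A [ u ]F ≃ C ⦄ → Γ ⊢ C
rewriting A e d = conv (≐-subst A e (conv d))

-- Addition and order.

plus-zeroˡ : Γ ⊢ ∀[ 𝟘 ] (plus · zero · v0 ≐ v0)
plus-zeroˡ = ind _ compute (∀-intro (⊃-intro (conv (congʳ suc h0))))

plus-sucˡ : Γ ⊢ ∀[ 𝟘 ] ∀[ 𝟘 ] (plus · (suc · v1) · v0 ≐ suc · (plus · v1 · v0))
plus-sucˡ = ∀-intro (ind _ compute (∀-intro (⊃-intro (conv (congʳ suc h0)))))

plus-comm : Γ ⊢ ∀[ 𝟘 ] ∀[ 𝟘 ] (plus · v1 · v0 ≐ plus · v0 · v1)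
plus-comm = ∀-intro (ind _ (conv (≐-sym (plus-zeroˡ at v0)))
  (∀-intro (⊃-intro (conv (≐-trans (congʳ suc h0) (≐-sym (plus-sucˡ at v0 at v1)))))))

plus-eq-zero : Γ ⊢ ∀[ 𝟘 ] ∀[ 𝟘 ] (plus · v1 · v0 ≐ zero ⊃ v1 ≐ zero)
plus-eq-zero = ind _ (∀-intro (⊃-intro ≐-refl))
  (∀-intro (⊃-intro (∀-intro (⊃-intro
    (⊥-elim (suc≢0 by ≐-trans (≐-sym (plus-sucˡ at v1 at v0)) h0))))))

≤one-cases : Γ ⊢ ∀[ 𝟘 ] (v0 ≤′ one ⊃ v0 ≐ zero ∨′ v0 ≐ one)
≤one-cases = ind _ (⊃-intro (∨-intro₁ ≐-refl))
  (∀-intro (⊃-intro (⊃-intro (∃-elim h0 (∨-intro₂ (congʳ suc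
    (plus-eq-zero at v1 at v0
      by suc-inj (≐-trans (≐-sym (plus-sucˡ at v1 at v0)) h0))))))))

≤-total : Γ ⊢ ∀[ 𝟘 ] ∀[ 𝟘 ] (v1 ≤′ v0 ∨′ v0 ≤′ v1)
≤-total = ind _ (∀-intro (∨-intro₁ (∃-intro v0 (plus-zeroˡ at v0))))
  (∀-intro (⊃-intro (ind _
    (∨-intro₂ (∃-intro (suc · v0) (plus-zeroˡ at suc · v0)))
    (∀-intro (⊃-intro (∨-elim (h1 at v0)
      (∃-elim h0 (∨-intro₁ (∃-intro v0 (≐-trans (plus-sucˡ at v2 at v0) (congʳ suc h0)))))
      (∃-elim h0 (∨-intro₂ (∃-intro v0 (≐-trans (plus-sucˡ at v1 at v0) (congʳ suc h0)))))))))))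

≮zero : Γ ⊢ ∀[ 𝟘 ] ¬′ (v0 <′ zero)
≮zero = ∀-intro (⊃-intro (∃-elim h0
  (suc≢0 by ≐-trans (≐-sym (plus-sucˡ at v1 at v0)) h0)))

zero<suc : Γ ⊢ ∀[ 𝟘 ] (zero <′ suc · v0)
zero<suc = ∀-intro (∃-intro v0
  (≐-trans (plus-sucˡ at zero at v0) (congʳ suc (plus-zeroˡ at v0))))

suc<suc : Γ ⊢ ∀[ 𝟘 ] ∀[ 𝟘 ] (v1 <′ v0 ⊃ suc · v1 <′ suc · v0)
suc<suc = ∀-intro (∀-intro (⊃-intro (∃-elim h0
  (∃-intro v0 (≐-trans (plus-sucˡ at suc · v2 at v0) (congʳ suc h0))))))

suc<suc⁻¹ : Γ ⊢ ∀[ 𝟘 ] ∀[ 𝟘 ] (suc · v1 <′ suc · v0 ⊃ v1 <′ v0)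
suc<suc⁻¹ = ∀-intro (∀-intro (⊃-intro (∃-elim h0
  (∃-intro v0 (suc-inj (≐-trans (≐-sym (plus-sucˡ at suc · v2 at v0)) h0))))))

v4 : ∀ {τ₀ τ₁ τ₂ τ₃} → Tm (τ₀ ∷ τ₁ ∷ τ₂ ∷ τ₃ ∷ τ ∷ Δ) τ
v4 = var (S (S (S (S Z))))

v5 : ∀ {τ₀ τ₁ τ₂ τ₃ τ₄} → Tm (τ₀ ∷ τ₁ ∷ τ₂ ∷ τ₃ ∷ τ₄ ∷ τ ∷ Δ) τ
v5 = var (S (S (S (S (S Z)))))

v6 : ∀ {τ₀ τ₁ τ₂ τ₃ τ₄ τ₅} → Tm (τ₀ ∷ τ₁ ∷ τ₂ ∷ τ₃ ∷ τ₄ ∷ τ₅ ∷ τ ∷ Δ) τ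
v6 = var (S (S (S (S (S (S Z))))))

v7 : ∀ {τ₀ τ₁ τ₂ τ₃ τ₄ τ₅ τ₆} → Tm (τ₀ ∷ τ₁ ∷ τ₂ ∷ τ₃ ∷ τ₄ ∷ τ₅ ∷ τ₆ ∷ τ ∷ Δ) τ
v7 = var (S (S (S (S (S (S (S Z)))))))

-- Initial segments and membership in sequences.

tail : Tm Δ (𝟙 ⇒ 𝟙)
tail = lam (lam (v1 · (suc · v0)))

-- Applying this projection and the next to an equation between `cons` terms yields injectivity of
-- `cons`.
headˢ : Tm Δ (𝟘 * ⇒ 𝟘)
headˢ = listrec · zero · lam (lam (lam v2))

tailˢ : Tm Δ (𝟘 * ⇒ 𝟘 *)
tailˢ = listrec · nil · lam (lam (lam v1))

-- `bar` grows at its end, whereas `cons` and `nth` work from the front. Peeling off the first entry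
-- leaves a segment of `tail`, so later inductions on length keep the function quantified.
bar-suc : Γ ⊢ ∀[ 𝟘 ] ∀[ 𝟙 ]
  (bar · v0 · (suc · v1) ≐ cons · (v0 · zero) · (bar · (tail · v0) · v1))
bar-suc = ind _ (∀-intro compute) (∀-intro (⊃-intro (∀-intro
  (conv (congʳ (lam (append · v0 · (cons · (v1 · (suc · v2)) · nil))) (h0 at v0))))))

bar-suc-cong : Γ ⊢ ∀[ 𝟘 ] ∀[ 𝟙 ] ∀[ 𝟙 ]
  (v1 · zero ≐ v0 · zero ⊃ bar · (tail · v1) · v2 ≐ bar · (tail · v0) · v2 ⊃
   bar · v1 · (suc · v2) ≐ bar · v0 · (suc · v2))
bar-suc-cong = ∀-intro (∀-intro (∀-intro (⊃-intro (⊃-intro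
  (≐-trans (bar-suc at v2 at v1)
    (≐-trans (cong· (congʳ cons h1) h0) (≐-sym (bar-suc at v2 at v0))))))))

bar-suc-inj : Γ ⊢ ∀[ 𝟘 ] ∀[ 𝟙 ] ∀[ 𝟙 ]
  (bar · v1 · (suc · v2) ≐ bar · v0 · (suc · v2) ⊃
   v1 · zero ≐ v0 · zero ∧′ bar · (tail · v1) · v2 ≐ bar · (tail · v0) · v2)
bar-suc-inj = ∀-intro (∀-intro (∀-intro (⊃-intro
  (have (≐-trans (≐-sym (bar-suc at v2 at v1)) (≐-trans h0 (bar-suc at v2 at v0)))
    (∧-intro (conv (congʳ headˢ h0)) (conv (congʳ tailˢ h0)))))))

bar-pred : Γ ⊢ ∀[ 𝟘 ] ∀[ 𝟙 ] ∀[ 𝟙 ]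
  (bar · v1 · (suc · v2) ≐ bar · v0 · (suc · v2) ⊃ bar · v1 · v2 ≐ bar · v0 · v2)
bar-pred = ind _ (∀-intro (∀-intro (⊃-intro compute)))
  (∀-intro (⊃-intro (∀-intro (∀-intro (⊃-intro
    (have (bar-suc-inj at suc · v2 at v1 at v0 by h0)
      (bar-suc-cong at v2 at v1 at v0
        by ∧-elim₁ h0
        by (h2 at tail · v1 at tail · v0 by ∧-elim₂ h0))))))))

-- The longer length is a sum because both `bound` and a witness of `≤′` have that form.
bar-restrict : Γ ⊢ ∀[ 𝟙 ] ∀[ 𝟙 ] ∀[ 𝟘 ] ∀[ 𝟘 ]
  (bar · v3 · (plus · v1 · v0) ≐ bar · v2 · (plus · v1 · v0) ⊃
   bar · v3 · v1 ≐ bar · v2 · v1)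
bar-restrict = ∀-intro (∀-intro (∀-intro (ind _ (⊃-intro (conv h0))
  (∀-intro (⊃-intro (⊃-intro
    (h1 by (bar-pred at plus · v1 · v0 at v3 at v2 by conv h0))))))))

∈[bar] : Γ ⊢ ∀[ 𝟘 ] ∀[ 𝟙 ] (v0 ∈[ bar · v0 · v1 ])
∈[bar] = ind _ (∀-intro (∀-intro (⊃-intro (⊥-elim (≮zero at v0 by conv h0)))))
  (∀-intro (⊃-intro (∀-intro
    -- After the first entry is split off, position 0 computes and position i + 1 is position i of
    -- the tail.
    (rewriting (v1 ∈[ v0 ]) (≐-sym (bar-suc at v1 at v0)) (ind
      (v0 <′ len · (cons · (v1 · zero) · (bar · (tail · v1) · v2)) ⊃
       v1 · v0 ≐ nth · (cons · (v1 · zero) · (bar · (tail · v1) · v2)) · v0)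
      (⊃-intro compute)
      (∀-intro (⊃-intro (⊃-intro (conv (h2 at tail · v1 at v0
        by (suc<suc⁻¹ at v0 at len · (bar · (tail · v1) · v2) by conv h0)))))))))))

mem-here : Γ ⊢ ∀[ 𝟙 ] ∀[ 𝟙 * ] (v1 ∈′ cons · v1 · v0)
mem-here = ∀-intro (∀-intro
  (∃-intro zero (∧-intro (conv (zero<suc at len · v0)) compute)))

mem-there : Γ ⊢ ∀[ 𝟙 ] ∀[ 𝟙 ] ∀[ 𝟙 * ] (v2 ∈′ v0 ⊃ v2 ∈′ cons · v1 · v0)
mem-there = ∀-intro (∀-intro (∀-intro (⊃-intro (∃-elim h0
  (∃-intro (suc · v0) (∧-intro
    (conv (suc<suc at v0 at len · v1 by ∧-elim₁ h0))
    (conv (∧-elim₂ h0))))))))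

-- Enumerating eventually constant binary sequences.

constant : Tm Δ (𝟘 ⇒ 𝟙)
constant = lam (lam v1)

prefix : Tm Δ (𝟘 ⇒ 𝟙 ⇒ 𝟙)
prefix = lam (lam (lam (rec · v2 · lam (lam (v3 · v1)) · v0)))

-- This describes `g` as f̄n * ccc... by its properties. Binarity is included because `MUC` compares
-- binary arguments.
Approximates : Tm Δ 𝟘 → Tm Δ 𝟘 → Tm Δ 𝟙 → Tm Δ 𝟙 → Fm Δ
Approximates c n f g =
  g ≤₁1 ∧′ bar · f · n ≐ bar · g · n ∧′ (∀[ 𝟘 ] (↑ g · (plus · ↑ n · v0) ≐ ↑ c))

prefix-approximates : Γ ⊢ ∀[ 𝟘 ] ∀[ 𝟘 ] ∀[ 𝟙 ] ∀[ 𝟘 ] ∀[ 𝟙 ]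
  (v1 ≤′ one ⊃ v2 · zero ≐ v1 ⊃ Approximates v4 v3 (tail · v2) v0 ⊃
   Approximates v4 (suc · v3) v2 (prefix · v1 · v0))
prefix-approximates =
  ∀-intro (∀-intro (∀-intro (∀-intro (∀-intro (⊃-intro (⊃-intro (⊃-intro
    (∧-intro (ind _ (conv h2) (∀-intro (⊃-intro (conv (∧-elim₁ h1 at v0)))))
    (∧-intro (bar-suc-cong at v3 at v2 at prefix · v1 · v0
                by conv h1 by conv (∧-elim₁ (∧-elim₂ h0)))
             -- `plus` recurses on its second argument, so the successor must first be pulled out of
             -- the left one for `prefix` to compute.
             (∀-intro (≐-trans (congʳ (prefix · v2 · v1) (plus-sucˡ at v4 at v0))
                               (conv (∧-elim₂ (∧-elim₂ h0) at v0)))))))))))))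

-- The digit goes inside the map built so far, so digits chosen later land further right.
branch : Tm Δ (𝟘 ⇒ (𝟙 ⇒ 𝟙) ⇒ 𝟙 ⇒ 𝟙)
branch = lam (lam (lam (v1 · (prefix · v2 · v0))))

-- enum · c · n · p · w prepends to w the objects p(σ * ccc…), for σ running
-- through the binary sequences of length n.
enum : Tm Δ (𝟘 ⇒ 𝟘 ⇒ (𝟙 ⇒ 𝟙) ⇒ 𝟙 * ⇒ 𝟙 *)
enum = lam (lam (rec
  · lam (lam (cons · (v1 · (constant · v3)) · v0))
  · lam (lam (lam (lam (v2 · (branch · zero · v1) · (v2 · (branch · one · v1) · v0)))))
  · v0))

-- The entries with first digit 1 form the accumulator for those with first digit 0, so they must
-- survive that second pass.
enum-extends : Γ ⊢ ∀[ 𝟘 ] ∀[ 𝟘 ] ∀[ 𝟙 ⇒ 𝟙 ] ∀[ 𝟙 * ] ∀[ 𝟙 ]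
  (v0 ∈′ v1 ⊃ v0 ∈′ enum · v4 · v3 · v2 · v1)
enum-extends = ∀-intro (ind _
  (∀-intro (∀-intro (∀-intro (⊃-intro
    (conv (mem-there at v0 at v2 · (constant · v3) at v1 by h0))))))
  (∀-intro (⊃-intro (∀-intro (∀-intro (∀-intro (⊃-intro
    (conv (h1 at branch · zero · v2 at enum · v4 · v3 · (branch · one · v2) · v1 at v0
      by (h1 at branch · one · v2 at v1 at v0 by h0))))))))))

-- Induction on the length, with the map, the accumulator and `f` all general: the first digit of
-- `f` moves into the map and its tail replaces `f`.
enum-approximates : Γ ⊢ ∀[ 𝟘 ] (v0 ≤′ one ⊃
  (∀[ 𝟘 ] ∀[ 𝟙 ⇒ 𝟙 ] ∀[ 𝟙 * ] ∀[ 𝟙 ] (v0 ≤₁1 ⊃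
    (∃[ 𝟙 ] (Approximates v5 v4 v1 v0 ∧′ v3 · v0 ∈′ enum · v5 · v4 · v3 · v2)))))
enum-approximates = ∀-intro (⊃-intro (ind _
  (∀-intro (∀-intro (∀-intro (⊃-intro (∃-intro (constant · v3)
    (∧-intro (∧-intro (∀-intro (conv h1)) (∧-intro compute (∀-intro compute)))
             (conv (mem-here at v2 · (constant · v3) at v1))))))))
  (∀-intro (⊃-intro (∀-intro (∀-intro (∀-intro (⊃-intro
    (∨-elim (≤one-cases at v0 · zero by (h0 at zero))
      (∃-elim
        (h2 at branch · zero · v2 at enum · v4 · v3 · (branch · one · v2) · v1 at tail · v0
          by ∀-intro (conv (h1 at suc · v0)))
        (∃-intro (prefix · zero · v0) (∧-intro
          (prefix-approximates at v5 at v4 at v1 at zero at v0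
            by ∃-intro one compute by h1 by ∧-elim₁ h0)
          (conv (∧-elim₂ h0)))))
      (∃-elim
        (h2 at branch · one · v2 at v1 at tail · v0
          by ∀-intro (conv (h1 at suc · v0)))
        (∃-intro (prefix · one · v0) (∧-intro
          (prefix-approximates at v5 at v4 at v1 at one at v0
            by ∃-intro zero compute by h1 by ∧-elim₁ h0)
          (conv (enum-extends at v5 at v4 at branch · zero · v3
                   at enum · v5 · v4 · (branch · one · v3) · v2
                   at v3 · (prefix · one · v0)
                   by conv (∧-elim₂ h0)))))))))))))))

-- From the intuitionistic to the special fan functional.

diagonal : Tm Δ (𝟚 ⇒ 𝟚)
diagonal = lam (lam (v0 · (v1 · v0)))

bound : Tm Δ ((𝟚 ⇒ 𝟘) ⇒ 𝟚 ⇒ 𝟘)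
bound = lam (lam (plus · (v1 · v0) · (v1 · (diagonal · v0))))

bound-correct : Γ ⊢ ∀[ 𝟚 ⇒ 𝟘 ] (MUC v0 ⊃ (∀[ 𝟚 ] ∀[ 𝟙 ] ∀[ 𝟙 ] ∀[ 𝟙 ]
  (Approximates zero (bound · v4 · v3) v2 v1 ⊃ Approximates one (bound · v4 · v3) v2 v0 ⊃
   bar · v2 · (v3 · v1) ≐ bar · v1 · (v3 · v1))))
bound-correct = ∀-intro (⊃-intro (∀-intro (∀-intro (∀-intro (∀-intro (⊃-intro (⊃-intro
  (have (≐-trans (≐-sym (∧-elim₁ (∧-elim₂ h1))) (∧-elim₁ (∧-elim₂ h0)))
  -- The first summand of the bound makes `G` agree on both approximations; the second, below, does
  -- the same for the diagonal.
  (have (h3 at v3 at v1 at v0 by ∧-elim₁ h2 by ∧-elim₁ h1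
          by (bar-restrict at v1 at v0 at v4 · v3 at v4 · (diagonal · v3) by conv h0))
  (have (h4 at diagonal · v3 at v1 at v0 by ∧-elim₁ h3 by ∧-elim₁ h2
          by (bar-restrict at v1 at v0 at v4 · (diagonal · v3) at v4 · v3
               by rewriting (bar · v2 · v0 ≐ bar · v1 · v0)
                    (plus-comm at v4 · v3 at v4 · (diagonal · v3)) h1))
  (∨-elim (≤-total at v3 · v1 at bound · v4 · v3)
    (∃-elim h0
      (bar-restrict at v3 at v2 at v4 · v2 at v0
        by rewriting (bar · v4 · v0 ≐ bar · v3 · v0) (≐-sym h0) (∧-elim₁ (∧-elim₂ h6))))
    -- Here the value of `G` is the bound plus some k. Both constant tails already start at the
    -- bound, so 1 = 0 follows even for k = 0.
    (∃-elim h0 (⊥-elim (suc≢0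
      by ≐-trans (≐-sym (∧-elim₂ (∧-elim₂ h5) at v0))
        (≐-trans (congʳ v1 (≐-trans h0 h3))
        (≐-trans (≐-sym (conv h2))
        (≐-trans (congʳ v2 (≐-sym h0))
          (∧-elim₂ (∧-elim₂ h6) at v0))))))))))))))))))

muc→sff : Tm Δ ((𝟚 ⇒ 𝟘) ⇒ 𝟚 ⇒ 𝟙 *)
muc→sff = lam (lam (enum · zero · (bound · v1 · v0) · lam v0 · nil))

muc→sff-correct : Γ ⊢ ∀[ 𝟚 ⇒ 𝟘 ] (MUC v0 ⊃ SFF (muc→sff · v0))
muc→sff-correct = ∀-intro (⊃-intro (∀-intro (∀-intro (⊃-intro
  (∃-elim (enum-approximates at zero by ∃-intro one compute
             at bound · v2 · v1 at lam v0 at nil at v0 by h0)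
  -- The companion ending in 111... is there for comparison; the witness chosen below is the entry
  -- ending in 000....
  (∃-elim (enum-approximates at one by ∃-intro zero compute
             at bound · v3 · v2 at lam v0 at nil at v1 by h1)
  (∃-intro v1 (∧-intro
    (conv (∧-elim₂ h1))
    (rewriting (v3 ∈[ v0 ])
      (bound-correct at v4 by h3 at v3 at v2 at v1 at v0 by ∧-elim₁ h1 by ∧-elim₁ h0)
      (∈[bar] at v3 · v1 at v2))))))))))

-- From the special fan functional to the effective fan theorem.

signum : Tm Δ (𝟘 ⇒ 𝟘)
signum = rec · zero · lam (lam one)

signum-≤one : Γ ⊢ ∀[ 𝟘 ] (signum · v0 ≤′ one)
signum-≤one = ind _ (∃-intro one compute) (∀-intro (⊃-intro (∃-intro zero compute)))

signum-id : Γ ⊢ ∀[ 𝟘 ] (v0 ≤′ one ⊃ v0 ≐ signum · v0)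
signum-id = ∀-intro (⊃-intro (∨-elim (≤one-cases at v0 by h0)
  (rewriting (v0 ≐ signum · v0) (≐-sym h0) (compute {t = zero} {u = signum · zero}))
  (rewriting (v0 ≐ signum · v0) (≐-sym h0) (compute {t = one} {u = signum · one}))))

truncate : Tm Δ (𝟙 ⇒ 𝟙)
truncate = lam (lam (signum · (v1 · v0)))

-- At the positions concerned the second function equals a binary one, and `signum` fixes 0 and 1.
bar-truncate : Γ ⊢ ∀[ 𝟘 ] ∀[ 𝟙 ] ∀[ 𝟙 ]
  (v1 ≤₁1 ⊃ v1 ∈[ bar · v0 · v2 ] ⊃ bar · v1 · v2 ≐ bar · (truncate · v0) · v2)
bar-truncate = ind _ (∀-intro (∀-intro (⊃-intro (⊃-intro compute))))
  (∀-intro (⊃-intro (∀-intro (∀-intro (⊃-intro (⊃-intro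
    (have {A = v1 ∈[ cons · (v0 · zero) · (bar · (tail · v0) · v2) ]}
      (rewriting (v2 ∈[ v0 ]) (bar-suc at v2 at v0) h0)
      (bar-suc-cong at v2 at v1 at truncate · v0
        by ≐-trans (signum-id at v1 · zero by (h2 at zero))
             (conv (congʳ signum (h0 at zero
               by conv (zero<suc at len · (bar · (tail · v0) · v2)))))
        by conv (h3 at tail · v1 at tail · v0
             by ∀-intro (conv (h2 at suc · v0))
             by ∀-intro (⊃-intro (conv (h1 at suc · v0
                  by conv (suc<suc at v0 at len · (bar · (tail · v1) · v3) by h0)))))))))))))

-- Downward closure read contrapositively, one entry at a time.
bar-∉-extends : Γ ⊢ ∀[ 𝟙 ] (IsBinaryTree v0 ⊃ (∀[ 𝟙 ] ∀[ 𝟘 ] ∀[ 𝟘 ]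
  (bar · v2 · v1 ∉ᵀ v3 ⊃ bar · v2 · (plus · v1 · v0) ∉ᵀ v3)))
bar-∉-extends = ∀-intro (⊃-intro (∀-intro (∀-intro (ind _ (⊃-intro (conv h0))
  (∀-intro (⊃-intro (⊃-intro (⊃-intro
    (h2 by h1 by (∧-elim₂ (∧-elim₂ h3)
      at bar · v2 · (plus · v1 · (suc · v0)) at bar · v2 · (plus · v1 · v0)
      by h0 by ∃-intro (cons · (v2 · (plus · v1 · v0)) · nil) compute))))))))))

sum : Tm Δ (𝟙 ⇒ 𝟘 ⇒ 𝟘)
sum = lam (rec · zero · lam (lam (plus · v0 · (v2 · v1))))

-- A sum dominates each summand. Its length has the form `suc i + k` supplied by a witness of i < n;
-- induction on k adds the later summands.
bar-∉-sum : Γ ⊢ ∀[ 𝟙 ] (IsBinaryTree v0 ⊃ (∀[ 𝟙 ] ∀[ 𝟙 ] ∀[ 𝟘 ]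
  (bar · v2 · (v1 · v0) ∉ᵀ v3 ⊃
   (∀[ 𝟘 ] (bar · v3 · (sum · v2 · (plus · (suc · v1) · v0)) ∉ᵀ v4)))))
bar-∉-sum = ∀-intro (⊃-intro (∀-intro (∀-intro (∀-intro (⊃-intro (ind _
  (rewriting (bar · v3 · v0 ∉ᵀ v4) (plus-comm at v1 · v0 at sum · v1 · v0)
    (bar-∉-extends at v3 by h1 at v2 at v1 · v0 at sum · v1 · v0 by h0))
  (∀-intro (⊃-intro (conv (bar-∉-extends at v4 by h2 at v3
    at sum · v2 · (plus · (suc · v1) · v0) at v2 · (plus · (suc · v1) · v0) by h0))))))))))

truncated : Tm Δ (𝟚 ⇒ 𝟚)
truncated = lam (lam (v1 · (truncate · v0)))

evaluate : Tm Δ (𝟙 * ⇒ 𝟚 ⇒ 𝟙)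
evaluate = lam (lam (lam (v1 · (nth · v2 · v0))))

sff→fan : Tm Δ ((𝟚 ⇒ 𝟙 *) ⇒ 𝟚 ⇒ 𝟙 ⇒ 𝟘)
sff→fan = lam (lam (lam
  (sum · (evaluate · (v2 · (truncated · v1)) · (truncated · v1))
       · (len · (v2 · (truncated · v1))))))

sff→fan-correct : Γ ⊢ ∀[ 𝟚 ⇒ 𝟙 * ] (SFF v0 ⊃ FANef (sff→fan · v0))
sff→fan-correct = ∀-intro (⊃-intro (∀-intro (⊃-intro (∀-intro (⊃-intro (∀-intro (⊃-intro
  (∃-elim (h3 at truncated · v1 at v0 by h0)
  (∃-elim (∧-elim₁ h0)
  (∃-elim (∧-elim₁ h0)
  -- By now there are an entry of the list, its index i, and k with `suc i + k` equal to the length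
  -- of the list.
  (rewriting
    (bar · v4 · (sum · (evaluate · (v7 · (truncated · v5)) · (truncated · v5)) · v0) ∉ᵀ v6) h0
    (bar-∉-sum at v5 by h5 at v3
      at evaluate · (v6 · (truncated · v4)) · (truncated · v4) at v1
      -- The truncated entry leaves the tree at the length `g` assigns to it. This passes to the
      -- given binary function, and the entry is then replaced by its indexed form.
      by conv (≐-subst (bar · v4 · (truncated · v5 · v0) ∉ᵀ v6) (∧-elim₂ h1)
           (rewriting (v0 ∉ᵀ v6)
             (≐-sym (bar-truncate at truncated · v4 · v2 at v3 at v2 by h3 by ∧-elim₂ h2))
             (h4 at truncate · v2 by ∀-intro (conv (signum-≤one at v3 · v0)))))
      at v0))))))))))))

theorem3p4 : Σ[ s ∈ ClosedTm ((𝟚 ⇒ 𝟙 *) ⇒ (𝟚 ⇒ 𝟙 ⇒ 𝟘)) ]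
    Σ[ t ∈ ClosedTm ((𝟚 ⇒ 𝟘) ⇒ (𝟚 ⇒ 𝟙 *)) ]
    E-PAω*⊢
    (∀[ 𝟚 ⇒ 𝟘 ] (MUC v0 ⊃ SFF (⌜ t ⌝ · v0)))
    ∧′ (∀[ 𝟚 ⇒ 𝟙 * ] (SFF v0 ⊃ FANef (⌜ s ⌝ · v0)))
theorem3p4 = sff→fan , muc→sff , ∧-intro muc→sff-correct sff→fan-correct
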